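{- (Soundness of the delay-free semantics.) For any statement $s$, state $\sigma$ and delay-free resumption $r:\mathit{res}_{\mathrm r}$, if $(s,\sigma)\Rightarrow_{\mathrm r}r$, then there exists a (delayful) resumption $r':\mathit{res}$ such that $(s,\sigma)\Rightarrow r'$ and $\mathit{emb}~r\cong r'$.
   Context: Language. Given sets of variables $x$ and pure expressions $e$; values are integers; states $\sigma$ map variables to integers; $\sigma[x\mapsto v]$ is state update; $\llbracket e\rrbracket\sigma\in\mathbb Z$ is the value of $e$ in $\sigma$; $\sigma\models e$ means $\llbracket e\rrbracket\sigma\neq 0$. Statements: $s::=\mathsf{skip}\mid s_0;s_1\mid x:=e\mid\mathsf{if}~e~\mathsf{then}~s_t~\mathsf{else}~s_f\mid\mathsf{while}~e~\mathsf{do}~s_t\mid\mathsf{input}~x\mid\mathsf{output}~e$. Delayful resumptions $r:\mathit{res}$ are defined coinductively by the constructors $\mathit{ret}~\sigma$, $\mathit{in}~f$ ($f:\mathbb Z\to\mathit{res}$), $\mathit{out}~v~r$ ($v\in\mathbb Z$), $\delta~r$. Strong bisimilarity $\approx$ is defined coinductively: $\mathit{ret}~\sigma\approx\mathit{ret}~\sigma$; $\mathit{in}~f\approx\mathit{in}~f_*$ if $\forall v.\,f\,v\approx f_*\,v$; $\mathit{out}~v~r\approx\mathit{out}~v~r_*$ if $r\approx r_*$; $\delta~r\approx\delta~r_*$ if $r\approx r_*$. Delay-free resumptions $r:\mathit{res}_{\mathrm r}$ are defined coinductively by constructors $\mathit{ret}_{\mathrm r}~\sigma$, $\mathit{in}_{\mathrm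 r}~f$ ($f:\mathbb Z\to\mathit{res}_{\mathrm r}$), $\mathit{out}_{\mathrm r}~v~r$, with strong bisimilarity $\approx$ defined coinductively by the analogous congruence rules. Strongly bisimilar resumptions count as equal (setoids with equality $\approx$), and all relations on resumptions are understood to respect $\approx$. The embedding $\mathit{emb}:\mathit{res}_{\mathrm r}\to\mathit{res}$ is defined corecursively: $\mathit{emb}(\mathit{ret}_{\mathrm r}~\sigma)=\mathit{ret}~\sigma$, $\mathit{emb}(\mathit{in}_{\mathrm r}~f)=\mathit{in}(\lambda v.\,\mathit{emb}(f\,v))$, $\mathit{emb}(\mathit{out}_{\mathrm r}~v~r)=\mathit{out}~v~(\mathit{emb}~r)$. Convergence $r\downarrow r'$ on $\mathit{res}$ is inductive: $\mathit{ret}~\sigma\downarrow\mathit{ret}~\sigma$; $\mathit{in}~f\downarrow\mathit{in}~f_*$ if $\forall v.\,f\,v\approx f_*\,v$; $\mathit{out}~v~r\downarrow\mathit{out}~v~r_*$ if $r\approx r_*$; $\delta~r\downarrow r'$ if $r\downarrow r'$. Weak bisimilarity $r\cong r_*$ on $\mathit{res}$ is coinductive: (1) $r\cong r_*$ if $r\downarrow\mathit{ret}~\sigma$ and $r_*\downarrow\mathit{ret}~\sigma$; (2) $r\cong r_*$ if $r\downarrow\mathit{in}~f$, $r_*\downarrow\mathit{in}~f_*$ and $\forall v.\,f\,v\cong f_*\,v$; (3) $r\cong r_*$ if $r\downarrow\mathit{out}~v~r'$, $r_*\downarrow\mathit{out}~v~r_*'$ and $r'\cong r'_*$; (4) $\delta~r\cong\delta~r_*$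 if $r\cong r_*$. Delayful big-step semantics. Evaluation $(s,\sigma)\Rightarrow r$ and its extended evaluation, written here $(s,r)\Rightarrow^{\mathrm{ext}}r'$ (on $\mathit{res}$), are defined mutually coinductively by: $(x:=e,\sigma)\Rightarrow\delta(\mathit{ret}~\sigma[x\mapsto\llbracket e\rrbracket\sigma])$; $(\mathsf{skip},\sigma)\Rightarrow\mathit{ret}~\sigma$; $(s_0;s_1,\sigma)\Rightarrow r'$ if $(s_0,\sigma)\Rightarrow r$ and $(s_1,r)\Rightarrow^{\mathrm{ext}}r'$; $(\mathsf{if}~e~\mathsf{then}~s_t~\mathsf{else}~s_f,\sigma)\Rightarrow r$ if either $\sigma\models e$ and $(s_t,\delta(\mathit{ret}~\sigma))\Rightarrow^{\mathrm{ext}}r$, or $\sigma\not\models e$ and $(s_f,\delta(\mathit{ret}~\sigma))\Rightarrow^{\mathrm{ext}}r$; $(\mathsf{while}~e~\mathsf{do}~s_t,\sigma)\Rightarrow r'$ if $\sigma\models e$, $(s_t,\delta(\mathit{ret}~\sigma))\Rightarrow^{\mathrm{ext}}r$ and $(\mathsf{while}~e~\mathsf{do}~s_t,r)\Rightarrow^{\mathrm{ext}}r'$; $(\mathsf{while}~e~\mathsf{do}~s_t,\sigma)\Rightarrow\delta(\mathit{ret}~\sigma)$ if $\sigma\not\models e$; $(\mathsf{input}~x,\sigma)\Rightarrow\mathit{in}(\lambda v.\,\mathit{ret}~\sigma[x\mapsto v])$; $(\mathsf{output}~e,\sigma)\Rightarrow\mathit{out}~(\llbracket e\rrbracket\sigma)~(\mathit{ret}~\sigma)$;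 $(s,\mathit{ret}~\sigma)\Rightarrow^{\mathrm{ext}}r$ if $(s,\sigma)\Rightarrow r$; $(s,\mathit{in}~f)\Rightarrow^{\mathrm{ext}}\mathit{in}~f'$ if $\forall v.\,(s,f\,v)\Rightarrow^{\mathrm{ext}}f'\,v$; $(s,\mathit{out}~v~r)\Rightarrow^{\mathrm{ext}}\mathit{out}~v~r'$ if $(s,r)\Rightarrow^{\mathrm{ext}}r'$; $(s,\delta~r)\Rightarrow^{\mathrm{ext}}\delta~r'$ if $(s,r)\Rightarrow^{\mathrm{ext}}r'$. Delay-free big-step semantics. For a relation $X$ between pairs (statement, delay-free resumption) and delay-free resumptions, written $(s,r)\mathbin X r'$, the relation $(s,\sigma)\mathbin{{\Rightarrow}{\downarrow}(X)}r$ ($r:\mathit{res}_{\mathrm r}$) is defined inductively; abbreviate it $(s,\sigma)\Downarrow_X r$: $(x:=e,\sigma)\Downarrow_X\mathit{ret}_{\mathrm r}(\sigma[x\mapsto\llbracket e\rrbracket\sigma])$; $(\mathsf{skip},\sigma)\Downarrow_X\mathit{ret}_{\mathrm r}~\sigma$; $(s_0;s_1,\sigma)\Downarrow_X r$ if $(s_0,\sigma)\Downarrow_X\mathit{ret}_{\mathrm r}~\sigma'$ and $(s_1,\sigma')\Downarrow_X r$; $(s_0;s_1,\sigma)\Downarrow_X\mathit{in}_{\mathrm r}~f'$ if $(s_0,\sigma)\Downarrow_X\mathit{in}_{\mathrm r}~f$ and $\forall v.\,(s_1,f\,v)\mathbin X f'\,v$; $(s_0;s_1,\sigma)\Downarrow_X\mathit{out}_{\mathrm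 r}~v~r'$ if $(s_0,\sigma)\Downarrow_X\mathit{out}_{\mathrm r}~v~r$ and $(s_1,r)\mathbin X r'$; $(\mathsf{if}~e~\mathsf{then}~s_t~\mathsf{else}~s_f,\sigma)\Downarrow_X r$ if $\sigma\models e$ and $(s_t,\sigma)\Downarrow_X r$, or $\sigma\not\models e$ and $(s_f,\sigma)\Downarrow_X r$; with $w=\mathsf{while}~e~\mathsf{do}~s_t$: $(w,\sigma)\Downarrow_X r$ if $\sigma\models e$, $(s_t,\sigma)\Downarrow_X\mathit{ret}_{\mathrm r}~\sigma'$ and $(w,\sigma')\Downarrow_X r$; $(w,\sigma)\Downarrow_X\mathit{in}_{\mathrm r}~f'$ if $\sigma\models e$, $(s_t,\sigma)\Downarrow_X\mathit{in}_{\mathrm r}~f$ and $\forall v.\,(w,f\,v)\mathbin X f'\,v$; $(w,\sigma)\Downarrow_X\mathit{out}_{\mathrm r}~v~r'$ if $\sigma\models e$, $(s_t,\sigma)\Downarrow_X\mathit{out}_{\mathrm r}~v~r$ and $(w,r)\mathbin X r'$; $(w,\sigma)\Downarrow_X\mathit{ret}_{\mathrm r}~\sigma$ if $\sigma\not\models e$; $(\mathsf{input}~x,\sigma)\Downarrow_X\mathit{in}_{\mathrm r}(\lambda v.\,\mathit{ret}_{\mathrm r}~\sigma[x\mapsto v])$; $(\mathsf{output}~e,\sigma)\Downarrow_X\mathit{out}_{\mathrm r}~(\llbracket e\rrbracket\sigma)~(\mathit{ret}_{\mathrm r}~\sigma)$. Extended evaluation $(s,r)\stackrel{*}{\Rightarrow}r'$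 on $\mathit{res}_{\mathrm r}$ is the coinductively defined (greatest) relation with rules: $(s,\mathit{ret}_{\mathrm r}~\sigma)\stackrel{*}{\Rightarrow}r$ if there is a relation $X\subseteq{\stackrel{*}{\Rightarrow}}$ with $(s,\sigma)\Downarrow_X r$; $(s,\mathit{in}_{\mathrm r}~f)\stackrel{*}{\Rightarrow}\mathit{in}_{\mathrm r}~f'$ if $\forall v.\,(s,f\,v)\stackrel{*}{\Rightarrow}f'\,v$; $(s,\mathit{out}_{\mathrm r}~v~r)\stackrel{*}{\Rightarrow}\mathit{out}_{\mathrm r}~v~r'$ if $(s,r)\stackrel{*}{\Rightarrow}r'$. Finally $(s,\sigma)\Rightarrow_{\mathrm r}r$ iff $(s,\sigma)\mathbin{{\Rightarrow}{\downarrow}({\stackrel{*}{\Rightarrow}})}r$. -}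

module Defs where

open import Data.Integer using (ℤ; 0ℤ)
open import Data.List using (List; []; _∷_)
open import Data.Product using (_×_; ∃-syntax)
open import Level using (Level)
open import Relation.Binary using (DecidableEquality)
open import Relation.Binary.PropositionalEquality using (_≡_; _≢_; refl)
open import Relation.Nullary using (¬_; yes; no)

-- Coinduction is encoded, without Agda's --guardedness:
--
-- * A coinductive type is given by a final coalgebra, with bisimilarity as
--   equality.  A resumption labels every address (a list of integers) with a
--   node; the child v of an input node sits below direction v, the only child
--   of an output or delay node below direction 0.  Addresses that do not occur
--   in the tree carry arbitrary labels, which 'observe' never reaches and
--   which strong bisimilarity therefore ignores.
--
-- * A coinductively defined (i.e. greatest) relation is the union of all
--   relations that are consistent with its rules.  The rules are a data type
--   whose parameters stand for the recursive premises of the rules.  The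
--   relations in the union are Set-valued, so the greatest one is in Set₁.
--
-- * Since a resumption is not literally built by a constructor, a rule with
--   conclusion  C[c], for a constructor form c, is written with a variable r
--   and a premise  r ▹ c  ("r unfolds to c").  Premises of the form  r ▹ c
--   also make the rules closed under strong bisimilarity.

record Language : Set₁ where
  field
    Var  : Set
    _≟_  : DecidableEquality Var
    Expr : Set

  State : Set
  State = Var → ℤ

  field
    ⟦_⟧ : Expr → State → ℤ

module Semantics (L : Language) where

  open Language L public

  infix  4 _⊨_ _⊭_
  infixl 20 _[_↦_]

  _[_↦_] : State → Var → ℤ → State
  (σ [ x ↦ v ]) y with y ≟ x
  ... | yes _ = v
  ... | no  _ = σ y

  _⊨_ _⊭_ : State → Expr → Set
  σ ⊨ e = ⟦ e ⟧ σ ≢ 0ℤ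
  σ ⊭ e = ¬ (σ ⊨ e)

  infixr 6 _⨾_
  infix  8 _≔_

  data Stmt : Set where
    skip          : Stmt
    _⨾_           : Stmt → Stmt → Stmt
    _≔_           : Var → Expr → Stmt
    if_then_else_ : Expr → Stmt → Stmt → Stmt
    while_loop_   : Expr → Stmt → Stmt
    input         : Var → Stmt
    output        : Expr → Stmt

  data F (A : Set) : Set where
    ret : State → F A
    inp : (ℤ → A) → F A
    out : ℤ → A → F A
    δ   : A → F A

  mapF : {A B : Set} → (A → B) → F A → F B
  mapF h (ret σ)   = ret σ
  mapF h (inp f)   = inp (λ v → h (f v))
  mapF h (out v a) = out v (h a)
  mapF h (δ a)     = δ (h a)

  data Node : Set where
    ret : State → Node
    inp : Node
    out : ℤ → Node
    δ   : Node

  Res : Set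
  Res = List ℤ → Node

  observe : Res → F Res
  observe r with r []
  ... | ret σ = ret σ
  ... | inp   = inp (λ v p → r (v ∷ p))
  ... | out v = out v (λ p → r (0ℤ ∷ p))
  ... | δ     = δ (λ p → r (0ℤ ∷ p))

  con : F Res → Res
  con (ret σ)   _       = ret σ
  con (inp f)   []      = inp
  con (inp f)   (v ∷ p) = f v p
  con (out v r) []      = out v
  con (out v r) (_ ∷ p) = r p
  con (δ r)     []      = δ
  con (δ r)     (_ ∷ p) = r p

  module _ {A : Set} (g : A → F A) where

    labels : F A → Res
    labels (ret σ)   _       = ret σ
    labels (inp f)   []      = inp
    labels (inp f)   (v ∷ p) = labels (g (f v)) p
    labels (out v a) []      = out v
    labels (out v a) (_ ∷ p) = labels (g a) p
    labels (δ a)     []      = δ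
    labels (δ a)     (_ ∷ p) = labels (g a) p

    corec : A → Res
    corec a = labels (g a)

    observe-corec : ∀ a → observe (corec a) ≡ mapF corec (g a)
    observe-corec a with g a
    ... | ret σ   = refl
    ... | inp f   = refl
    ... | out v b = refl
    ... | δ b     = refl

  observe-con : ∀ u → observe (con u) ≡ u
  observe-con (ret σ)   = refl
  observe-con (inp f)   = refl
  observe-con (out v r) = refl
  observe-con (δ r)     = refl

  infix 4 _▹_ _≈_ _↓_ _≅_

  _▹_ : Res → F Res → Set
  r ▹ u = observe r ≡ u

  data StrongRules {ℓ : Level} (R : Res → Res → Set ℓ) (r r⋆ : Res) : Set ℓ where
    ret : ∀ {σ} → r ▹ ret σ → r⋆ ▹ ret σ → StrongRules R r r⋆
    inp : ∀ {f f⋆} → r ▹ inp f → r⋆ ▹ inp f⋆ →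
          (∀ v → R (f v) (f⋆ v)) → StrongRules R r r⋆
    out : ∀ {v r₁ r⋆₁} → r ▹ out v r₁ → r⋆ ▹ out v r⋆₁ →
          R r₁ r⋆₁ → StrongRules R r r⋆
    δ   : ∀ {r₁ r⋆₁} → r ▹ δ r₁ → r⋆ ▹ δ r⋆₁ →
          R r₁ r⋆₁ → StrongRules R r r⋆

  _≈_ : Res → Res → Set₁
  r ≈ r⋆ = ∃[ R ] (∀ {q q⋆} → R q q⋆ → StrongRules R q q⋆) × R r r⋆

  data _↓_ (r r′ : Res) : Set₁ where
    ret : ∀ {σ} → r ▹ ret σ → r′ ▹ ret σ → r ↓ r′
    inp : ∀ {f f⋆} → r ▹ inp f → r′ ▹ inp f⋆ → (∀ v → f v ≈ f⋆ v) → r ↓ r′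
    out : ∀ {v r₁ r⋆} → r ▹ out v r₁ → r′ ▹ out v r⋆ → r₁ ≈ r⋆ → r ↓ r′
    δ   : ∀ {r₁} → r ▹ δ r₁ → r₁ ↓ r′ → r ↓ r′

  data WeakRules (R : Res → Res → Set) (r r⋆ : Res) : Set₁ where
    ret : ∀ {σ} → r ↓ con (ret σ) → r⋆ ↓ con (ret σ) → WeakRules R r r⋆
    inp : ∀ {f f⋆} → r ↓ con (inp f) → r⋆ ↓ con (inp f⋆) →
          (∀ v → R (f v) (f⋆ v)) → WeakRules R r r⋆
    out : ∀ {v r′ r⋆′} → r ↓ con (out v r′) → r⋆ ↓ con (out v r⋆′) →
          R r′ r⋆′ → WeakRules R r r⋆
    δ   : ∀ {r₁ r⋆₁} → r ▹ δ r₁ → r⋆ ▹ δ r⋆₁ →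
          R r₁ r⋆₁ → WeakRules R r r⋆

  _≅_ : Res → Res → Set₁
  r ≅ r⋆ = ∃[ R ] (∀ {q q⋆} → R q q⋆ → WeakRules R q q⋆) × R r r⋆

  data Fᵣ (A : Set) : Set where
    retᵣ : State → Fᵣ A
    inpᵣ : (ℤ → A) → Fᵣ A
    outᵣ : ℤ → A → Fᵣ A

  data Nodeᵣ : Set where
    retᵣ : State → Nodeᵣ
    inpᵣ : Nodeᵣ
    outᵣ : ℤ → Nodeᵣ

  mapFᵣ : {A B : Set} → (A → B) → Fᵣ A → Fᵣ B
  mapFᵣ h (retᵣ σ)   = retᵣ σ
  mapFᵣ h (inpᵣ f)   = inpᵣ (λ v → h (f v))
  mapFᵣ h (outᵣ v a) = outᵣ v (h a)

  Resᵣ : Set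
  Resᵣ = List ℤ → Nodeᵣ

  observeᵣ : Resᵣ → Fᵣ Resᵣ
  observeᵣ r with r []
  ... | retᵣ σ = retᵣ σ
  ... | inpᵣ   = inpᵣ (λ v p → r (v ∷ p))
  ... | outᵣ v = outᵣ v (λ p → r (0ℤ ∷ p))

  conᵣ : Fᵣ Resᵣ → Resᵣ
  conᵣ (retᵣ σ)   _       = retᵣ σ
  conᵣ (inpᵣ f)   []      = inpᵣ
  conᵣ (inpᵣ f)   (v ∷ p) = f v p
  conᵣ (outᵣ v r) []      = outᵣ v
  conᵣ (outᵣ v r) (_ ∷ p) = r p

  module _ {A : Set} (g : A → Fᵣ A) where

    labelsᵣ : Fᵣ A → Resᵣ
    labelsᵣ (retᵣ σ)   _       = retᵣ σ
    labelsᵣ (inpᵣ f)   []      = inpᵣ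
    labelsᵣ (inpᵣ f)   (v ∷ p) = labelsᵣ (g (f v)) p
    labelsᵣ (outᵣ v a) []      = outᵣ v
    labelsᵣ (outᵣ v a) (_ ∷ p) = labelsᵣ (g a) p

    corecᵣ : A → Resᵣ
    corecᵣ a = labelsᵣ (g a)

    observe-corecᵣ : ∀ a → observeᵣ (corecᵣ a) ≡ mapFᵣ corecᵣ (g a)
    observe-corecᵣ a with g a
    ... | retᵣ σ   = refl
    ... | inpᵣ f   = refl
    ... | outᵣ v b = refl

  observe-conᵣ : ∀ u → observeᵣ (conᵣ u) ≡ u
  observe-conᵣ (retᵣ σ)   = refl
  observe-conᵣ (inpᵣ f)   = refl
  observe-conᵣ (outᵣ v r) = refl

  infix 4 _▹ᵣ_ _≈ᵣ_

  _▹ᵣ_ : Resᵣ → Fᵣ Resᵣ → Set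
  r ▹ᵣ u = observeᵣ r ≡ u

  data StrongRulesᵣ {ℓ : Level} (R : Resᵣ → Resᵣ → Set ℓ) (r r⋆ : Resᵣ) : Set ℓ where
    retᵣ : ∀ {σ} → r ▹ᵣ retᵣ σ → r⋆ ▹ᵣ retᵣ σ → StrongRulesᵣ R r r⋆
    inpᵣ : ∀ {f f⋆} → r ▹ᵣ inpᵣ f → r⋆ ▹ᵣ inpᵣ f⋆ →
           (∀ v → R (f v) (f⋆ v)) → StrongRulesᵣ R r r⋆
    outᵣ : ∀ {v r₁ r⋆₁} → r ▹ᵣ outᵣ v r₁ → r⋆ ▹ᵣ outᵣ v r⋆₁ →
           R r₁ r⋆₁ → StrongRulesᵣ R r r⋆

  _≈ᵣ_ : Resᵣ → Resᵣ → Set₁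
  r ≈ᵣ r⋆ = ∃[ R ] (∀ {q q⋆} → R q q⋆ → StrongRulesᵣ R q q⋆) × R r r⋆

  embF : {A : Set} → Fᵣ A → F A
  embF (retᵣ σ)   = ret σ
  embF (inpᵣ f)   = inp f
  embF (outᵣ v a) = out v a

  emb : Resᵣ → Res
  emb = corec (λ r → embF (observeᵣ r))

  observe-emb-con : ∀ u → observe (emb (conᵣ u)) ≡ mapF emb (embF u)
  observe-emb-con (retᵣ σ)   = refl
  observe-emb-con (inpᵣ f)   = refl
  observe-emb-con (outᵣ v r) = refl

  -- X and Y stand for the occurrences of
  -- evaluation and extended evaluation in the premises of the rules.

  module _ (X : Stmt → State → Res → Set) (Y : Stmt → Res → Res → Set) where

    data EvalRules : Stmt → State → Res → Set where
      assign  : ∀ {x e σ r r₁} →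
                r ▹ δ r₁ → r₁ ▹ ret (σ [ x ↦ ⟦ e ⟧ σ ]) → EvalRules (x ≔ e) σ r
      skip    : ∀ {σ r} → r ▹ ret σ → EvalRules skip σ r
      seq     : ∀ {s₀ s₁ σ r r′} →
                X s₀ σ r → Y s₁ r r′ → EvalRules (s₀ ⨾ s₁) σ r′
      if-tt   : ∀ {e sᵗ sᶠ σ r} →
                σ ⊨ e → Y sᵗ (con (δ (con (ret σ)))) r →
                EvalRules (if e then sᵗ else sᶠ) σ r
      if-ff   : ∀ {e sᵗ sᶠ σ r} →
                σ ⊭ e → Y sᶠ (con (δ (con (ret σ)))) r →
                EvalRules (if e then sᵗ else sᶠ) σ r
      loop-tt : ∀ {e sᵗ σ r r′} →
                σ ⊨ e → Y sᵗ (con (δ (con (ret σ)))) r → Y (while e loop sᵗ) r r′ →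
                EvalRules (while e loop sᵗ) σ r′
      loop-ff : ∀ {e sᵗ σ r r₁} →
                σ ⊭ e → r ▹ δ r₁ → r₁ ▹ ret σ → EvalRules (while e loop sᵗ) σ r
      input   : ∀ {x σ r f} →
                r ▹ inp f → (∀ v → f v ▹ ret (σ [ x ↦ v ])) → EvalRules (input x) σ r
      output  : ∀ {e σ r r₁} →
                r ▹ out (⟦ e ⟧ σ) r₁ → r₁ ▹ ret σ → EvalRules (output e) σ r

    data ExtRules (s : Stmt) (r r′ : Res) : Set where
      ret : ∀ {σ} → r ▹ ret σ → X s σ r′ → ExtRules s r r′
      inp : ∀ {f f′} → r ▹ inp f → r′ ▹ inp f′ →
            (∀ v → Y s (f v) (f′ v)) → ExtRules s r r′
      out : ∀ {v r₁ r′₁} → r ▹ out v r₁ → r′ ▹ out v r′₁ →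
            Y s r₁ r′₁ → ExtRules s r r′
      δ   : ∀ {r₁ r′₁} → r ▹ δ r₁ → r′ ▹ δ r′₁ →
            Y s r₁ r′₁ → ExtRules s r r′

    Consistent : Set
    Consistent = (∀ {s σ r} → X s σ r → EvalRules s σ r)
               × (∀ {s r r′} → Y s r r′ → ExtRules s r r′)

  infix 4 ⟨_,_⟩⇒_ ⟨_,_⟩⇒ᵉˣᵗ_

  ⟨_,_⟩⇒_ : Stmt → State → Res → Set₁
  ⟨ s , σ ⟩⇒ r = ∃[ X ] ∃[ Y ] Consistent X Y × X s σ r

  ⟨_,_⟩⇒ᵉˣᵗ_ : Stmt → Res → Res → Set₁
  ⟨ s , r ⟩⇒ᵉˣᵗ r′ = ∃[ X ] ∃[ Y ] Consistent X Y × Y s r r′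

  infix 4 _⊢⟨_,_⟩⇓_ ⟨_,_⟩⇒*_ ⟨_,_⟩⇒ᵣ_

  data _⊢⟨_,_⟩⇓_ {ℓ : Level} (X : Stmt → Resᵣ → Resᵣ → Set ℓ) :
         Stmt → State → Resᵣ → Set ℓ where
    assign   : ∀ {x e σ r} →
               r ▹ᵣ retᵣ (σ [ x ↦ ⟦ e ⟧ σ ]) → X ⊢⟨ x ≔ e , σ ⟩⇓ r
    skip     : ∀ {σ r} → r ▹ᵣ retᵣ σ → X ⊢⟨ skip , σ ⟩⇓ r
    seq-ret  : ∀ {s₀ s₁ σ σ′ r} →
               X ⊢⟨ s₀ , σ ⟩⇓ conᵣ (retᵣ σ′) → X ⊢⟨ s₁ , σ′ ⟩⇓ r →
               X ⊢⟨ s₀ ⨾ s₁ , σ ⟩⇓ r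
    seq-inp  : ∀ {s₀ s₁ σ f f′ r} →
               X ⊢⟨ s₀ , σ ⟩⇓ conᵣ (inpᵣ f) → (∀ v → X s₁ (f v) (f′ v)) →
               r ▹ᵣ inpᵣ f′ → X ⊢⟨ s₀ ⨾ s₁ , σ ⟩⇓ r
    seq-out  : ∀ {s₀ s₁ σ v r₀ r′ r} →
               X ⊢⟨ s₀ , σ ⟩⇓ conᵣ (outᵣ v r₀) → X s₁ r₀ r′ →
               r ▹ᵣ outᵣ v r′ → X ⊢⟨ s₀ ⨾ s₁ , σ ⟩⇓ r
    if-tt    : ∀ {e sᵗ sᶠ σ r} →
               σ ⊨ e → X ⊢⟨ sᵗ , σ ⟩⇓ r → X ⊢⟨ if e then sᵗ else sᶠ , σ ⟩⇓ r
    if-ff    : ∀ {e sᵗ sᶠ σ r} →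
               σ ⊭ e → X ⊢⟨ sᶠ , σ ⟩⇓ r → X ⊢⟨ if e then sᵗ else sᶠ , σ ⟩⇓ r
    loop-ret : ∀ {e sᵗ σ σ′ r} →
               σ ⊨ e → X ⊢⟨ sᵗ , σ ⟩⇓ conᵣ (retᵣ σ′) →
               X ⊢⟨ while e loop sᵗ , σ′ ⟩⇓ r → X ⊢⟨ while e loop sᵗ , σ ⟩⇓ r
    loop-inp : ∀ {e sᵗ σ f f′ r} →
               σ ⊨ e → X ⊢⟨ sᵗ , σ ⟩⇓ conᵣ (inpᵣ f) →
               (∀ v → X (while e loop sᵗ) (f v) (f′ v)) →
               r ▹ᵣ inpᵣ f′ → X ⊢⟨ while e loop sᵗ , σ ⟩⇓ r
    loop-out : ∀ {e sᵗ σ v r₀ r′ r} →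
               σ ⊨ e → X ⊢⟨ sᵗ , σ ⟩⇓ conᵣ (outᵣ v r₀) →
               X (while e loop sᵗ) r₀ r′ →
               r ▹ᵣ outᵣ v r′ → X ⊢⟨ while e loop sᵗ , σ ⟩⇓ r
    loop-ff  : ∀ {e sᵗ σ r} →
               σ ⊭ e → r ▹ᵣ retᵣ σ → X ⊢⟨ while e loop sᵗ , σ ⟩⇓ r
    input    : ∀ {x σ r f} →
               r ▹ᵣ inpᵣ f → (∀ v → f v ▹ᵣ retᵣ (σ [ x ↦ v ])) →
               X ⊢⟨ input x , σ ⟩⇓ r
    output   : ∀ {e σ r r₁} →
               r ▹ᵣ outᵣ (⟦ e ⟧ σ) r₁ → r₁ ▹ᵣ retᵣ σ → X ⊢⟨ output e , σ ⟩⇓ r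

  RespectsBisimilarity : (Stmt → Resᵣ → Resᵣ → Set) → Set₁
  RespectsBisimilarity X =
    ∀ {s r q r′ q′} → r ≈ᵣ q → r′ ≈ᵣ q′ → X s r r′ → X s q q′

  -- R stands for the extended evaluation relation being defined.
  data ExtRulesᵣ (R : Stmt → Resᵣ → Resᵣ → Set) (s : Stmt) (r r′ : Resᵣ) : Set₁ where
    retᵣ : ∀ {σ} → r ▹ᵣ retᵣ σ →
           (X : Stmt → Resᵣ → Resᵣ → Set) → RespectsBisimilarity X →
           (∀ {t q q′} → X t q q′ → R t q q′) →
           X ⊢⟨ s , σ ⟩⇓ r′ → ExtRulesᵣ R s r r′
    inpᵣ : ∀ {f f′} → r ▹ᵣ inpᵣ f → r′ ▹ᵣ inpᵣ f′ →
           (∀ v → R s (f v) (f′ v)) → ExtRulesᵣ R s r r′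
    outᵣ : ∀ {v r₁ r′₁} → r ▹ᵣ outᵣ v r₁ → r′ ▹ᵣ outᵣ v r′₁ →
           R s r₁ r′₁ → ExtRulesᵣ R s r r′

  ⟨_,_⟩⇒*_ : Stmt → Resᵣ → Resᵣ → Set₁
  ⟨ s , r ⟩⇒* r′ = ∃[ R ] (∀ {t q q′} → R t q q′ → ExtRulesᵣ R t q q′) × R s r r′

  ⟨_,_⟩⇒ᵣ_ : Stmt → State → Resᵣ → Set₁
  ⟨ s , σ ⟩⇒ᵣ r = (λ t q q′ → ⟨ t , q ⟩⇒* q′) ⊢⟨ s , σ ⟩⇓ r

-- The delayful semantics is total: a structurally recursive small-step function,
-- each step of which emits one node, is iterated to a resumption eval (s , σ)
-- with (s , σ) ⇒ eval (s , σ).  It remains to compare emb r with eval (s , σ).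
-- Weak bisimilarity demands a Set-valued bisimulation, whereas ⇒ᵣ lives in Set₁;
-- the bisimulation is therefore the intersection over n of the relations "equal
-- up to depth n after removing delays", each of which is small.  Agreement to
-- depth n follows by induction on n and, inside, on the derivation of ⇓.
module Submission where

open import Data.Integer using (0ℤ)
open import Data.Integer.Properties using (_≟_)
open import Data.List using ([]; _∷_)
open import Data.Nat using (ℕ; zero; suc)
open import Data.Product using (_×_; _,_; ∃-syntax)
open import Data.Unit using (⊤; tt)
open import Level using (Level)
open import Relation.Binary.PropositionalEquality
  using (_≡_; _≗_; refl; sym; trans)
open import Relation.Nullary using (¬_; yes; no; contradiction)
open import Defs

module Soundness (L : Language) where

  open Semantics L hiding (_≟_)

  Config : Set
  Config = Stmt × State

  infixl 6 _⨾ᶜ_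

  _⨾ᶜ_ : Config → Stmt → Config
  (s , σ) ⨾ᶜ t = s ⨾ t , σ

  -- "ret σ" means that a statement terminates in σ without emitting a node.
  continue : (State → F Config) → Stmt → F Config → F Config
  continue k s (ret σ)   = k σ
  continue k s (inp g)   = inp (λ v → g v ⨾ᶜ s)
  continue k s (out v c) = out v (c ⨾ᶜ s)
  continue k s (δ c)     = δ (c ⨾ᶜ s)

  choose : {A : Set} → Expr → State → A → A → A
  choose e σ a b with ⟦ e ⟧ σ ≟ 0ℤ
  ... | yes _ = b
  ... | no  _ = a

  -- A step into a statement t leads to skip ⨾ t, as evaluation of t is extended
  -- along δ (ret σ); the step of skip ⨾ t is that of t.
  step : Stmt → State → F Config
  step skip                    σ = ret σ
  step (s₀ ⨾ s₁)               σ = continue (step s₁) s₁ (step s₀ σ)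
  step (x ≔ e)                 σ = δ (skip , σ [ x ↦ ⟦ e ⟧ σ ])
  step (if e then sᵗ else sᶠ)  σ = δ (choose e σ (skip ⨾ sᵗ , σ) (skip ⨾ sᶠ , σ))
  step (while e loop sᵗ)       σ =
    δ (choose e σ ((skip ⨾ sᵗ) ⨾ while e loop sᵗ , σ) (skip , σ))
  step (input x)               σ = inp (λ v → skip , σ [ x ↦ v ])
  step (output e)              σ = out (⟦ e ⟧ σ) (skip , σ)

  stepᶜ : Config → F Config
  stepᶜ (s , σ) = step s σ

  bind : Stmt → F Config → F Config
  bind s = continue (step s) s

  run : F Config → Res
  run = labels stepᶜ

  eval : Config → Res
  eval = corec stepᶜ

  ▹-ret : ∀ {r σ} → r [] ≡ ret σ → r ▹ ret σ
  ▹-ret eq rewrite eq = refl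

  ▹-inp : ∀ {r} → r [] ≡ inp → r ▹ inp (λ v p → r (v ∷ p))
  ▹-inp eq rewrite eq = refl

  ▹-out : ∀ {r v} → r [] ≡ out v → r ▹ out v (λ p → r (0ℤ ∷ p))
  ▹-out eq rewrite eq = refl

  ▹-δ : ∀ {r} → r [] ≡ δ → r ▹ δ (λ p → r (0ℤ ∷ p))
  ▹-δ eq rewrite eq = refl

  -- Resumptions are compared pointwise for lack of function extensionality.
  Eval : Stmt → State → Res → Set
  Eval s σ r = r ≗ run (step s σ)

  -- The witness `u` presents `r` as a return or one emitted node, so the four cases of `bind s u`
  -- are the four rules of extended evaluation.
  Ext : Stmt → Res → Res → Set
  Ext s r r′ = ∃[ u ] r ≗ run u × r′ ≗ run (bind s u)

  delayed : ∀ σ → con (δ (con (ret σ))) ≗ run (δ (skip , σ))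
  delayed σ []      = refl
  delayed σ (_ ∷ p) = refl

  eval-rules : ∀ s {σ r} → Eval s σ r → EvalRules Eval Ext s σ r
  eval-rules skip h = skip (▹-ret (h []))
  eval-rules (s₀ ⨾ s₁) {σ} h =
    seq {r = run (step s₀ σ)} (λ _ → refl) (step s₀ σ , (λ _ → refl) , h)
  eval-rules (x ≔ e) h = assign (▹-δ (h [])) (▹-ret (h (0ℤ ∷ [])))
  eval-rules (if e then sᵗ else sᶠ) {σ} h with ⟦ e ⟧ σ ≟ 0ℤ
  ... | yes e≡0 = if-ff (λ e≢0 → e≢0 e≡0) (δ (skip , σ) , delayed σ , h)
  ... | no  e≢0 = if-tt e≢0 (δ (skip , σ) , delayed σ , h)
  eval-rules (while e loop sᵗ) {σ} h with ⟦ e ⟧ σ ≟ 0ℤ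
  ... | yes e≡0 = loop-ff (λ e≢0 → e≢0 e≡0) (▹-δ (h [])) (▹-ret (h (0ℤ ∷ [])))
  ... | no  e≢0 =
    -- Binding the loop to this intermediate step gives, by computation, the step of the loop itself
    -- when the guard holds.
    loop-tt {r = run (δ (skip ⨾ sᵗ , σ))} e≢0
      (δ (skip , σ) , delayed σ , λ _ → refl)
      (δ (skip ⨾ sᵗ , σ) , (λ _ → refl) , h)
  eval-rules (input x)  h = input (▹-inp (h [])) (λ v → ▹-ret (h (v ∷ [])))
  eval-rules (output e) h = output (▹-out (h [])) (▹-ret (h (0ℤ ∷ [])))

  ext-rules : ∀ {s r r′} → Ext s r r′ → ExtRules Eval Ext s r r′
  ext-rules (ret σ , h , h′) = ret (▹-ret (h [])) h′
  ext-rules (inp g , h , h′) =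
    inp (▹-inp (h [])) (▹-inp (h′ []))
      (λ v → stepᶜ (g v) , (λ p → h (v ∷ p)) , (λ p → h′ (v ∷ p)))
  ext-rules (out v c , h , h′) =
    out (▹-out (h [])) (▹-out (h′ []))
      (stepᶜ c , (λ p → h (0ℤ ∷ p)) , (λ p → h′ (0ℤ ∷ p)))
  ext-rules (δ c , h , h′) =
    δ (▹-δ (h [])) (▹-δ (h′ []))
      (stepᶜ c , (λ p → h (0ℤ ∷ p)) , (λ p → h′ (0ℤ ∷ p)))

  ⇒-eval : ∀ s σ → ⟨ s , σ ⟩⇒ eval (s , σ)
  ⇒-eval s σ = Eval , Ext , (eval-rules _ , ext-rules) , λ _ → refl

  -- Being inductive, it allows only finitely many delays before the node, as `_↓_` does; `R`
  -- governs what lies below the node.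
  data Agree (R : Resᵣ → Config → Set) : Fᵣ Resᵣ → F Config → Set where
    ret : ∀ {σ} → Agree R (retᵣ σ) (ret σ)
    inp : ∀ {f g} → (∀ v → R (f v) (g v)) → Agree R (inpᵣ f) (inp g)
    out : ∀ {v r c} → R r c → Agree R (outᵣ v r) (out v c)
    δ   : ∀ {w c} → Agree R w (stepᶜ c) → Agree R w (δ c)

  δ-⊨ : ∀ {R w} e {σ c c′} → σ ⊨ e → Agree R w (stepᶜ c) →
        Agree R w (δ (choose e σ c c′))
  δ-⊨ e {σ} σ⊨e a with ⟦ e ⟧ σ ≟ 0ℤ
  ... | yes e≡0 = contradiction e≡0 σ⊨e
  ... | no  _   = δ a

  δ-⊭ : ∀ {R w} e {σ c c′} → σ ⊭ e → Agree R w (stepᶜ c′) →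
        Agree R w (δ (choose e σ c c′))
  δ-⊭ e {σ} σ⊭e a with ⟦ e ⟧ σ ≟ 0ℤ
  ... | yes _   = δ a
  ... | no  e≢0 = contradiction e≢0 σ⊭e

  Agrees : ℕ → Resᵣ → Config → Set
  Agrees zero    _ _ = ⊤
  Agrees (suc n) r c = Agree (Agrees n) (observeᵣ r) (stepᶜ c)

  module _ {R : Resᵣ → Config → Set} (s : Stmt) where

    Extends : Resᵣ → Resᵣ → Set
    Extends r r′ = ∀ {c} → R r c → R r′ (c ⨾ᶜ s)

    bind-ret : ∀ {σ w u} → Agree R (retᵣ σ) u → Agree R w (step s σ) →
               Agree R w (bind s u)
    bind-ret ret   b = b
    bind-ret (δ a) b = δ (bind-ret a b)

    bind-inp : ∀ {f f′ u} → Agree R (inpᵣ f) u → (∀ v → Extends (f v) (f′ v)) →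
               Agree R (inpᵣ f′) (bind s u)
    bind-inp (inp h) ext = inp (λ v → ext v (h v))
    bind-inp (δ a)   ext = δ (bind-inp a ext)

    bind-out : ∀ {v r r′ u} → Agree R (outᵣ v r) u → Extends r r′ →
               Agree R (outᵣ v r′) (bind s u)
    bind-out (out h) ext = out (ext h)
    bind-out (δ a)   ext = δ (bind-out a ext)

  skip-agree : ∀ n {r σ} → r ▹ᵣ retᵣ σ → Agrees n r (skip , σ)
  skip-agree zero    _  = tt
  skip-agree (suc n) eq rewrite eq = ret

  module _ {ℓ : Level} {X : Stmt → Resᵣ → Resᵣ → Set ℓ} (n : ℕ)
           (ext : ∀ {t q q′} → X t q q′ → Extends {Agrees n} t q q′) where

    -- Premises in `X` occur only below an input or output node, so `ext` at depth `n` suffices for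
    -- agreement at depth `suc n`.
    ⇓-agree : ∀ {s σ r} → X ⊢⟨ s , σ ⟩⇓ r →
              Agree (Agrees n) (observeᵣ r) (step s σ)
    ⇓-agree (assign eq) rewrite eq = δ ret
    ⇓-agree (skip eq) rewrite eq = ret
    ⇓-agree (seq-ret {s₁ = s₁} d₀ d₁) = bind-ret s₁ (⇓-agree d₀) (⇓-agree d₁)
    ⇓-agree (seq-inp {s₁ = s₁} d x eq) rewrite eq =
      bind-inp s₁ (⇓-agree d) (λ v → ext (x v))
    ⇓-agree (seq-out {s₁ = s₁} d x eq) rewrite eq =
      bind-out s₁ (⇓-agree d) (ext x)
    ⇓-agree (if-tt {e} σ⊨e d) = δ-⊨ e σ⊨e (⇓-agree d)
    ⇓-agree (if-ff {e} σ⊭e d) = δ-⊭ e σ⊭e (⇓-agree d)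
    -- The leading `skip` computes away: after the delay, the step is
    -- `bind (while e loop sᵗ) (step sᵗ σ)`.
    ⇓-agree (loop-ret {e} {sᵗ} σ⊨e d₀ d₁) =
      δ-⊨ e σ⊨e (bind-ret (while e loop sᵗ) (⇓-agree d₀) (⇓-agree d₁))
    ⇓-agree (loop-inp {e} {sᵗ} σ⊨e d x eq) rewrite eq =
      δ-⊨ e σ⊨e (bind-inp (while e loop sᵗ) (⇓-agree d) (λ v → ext (x v)))
    ⇓-agree (loop-out {e} {sᵗ} σ⊨e d x eq) rewrite eq =
      δ-⊨ e σ⊨e (bind-out (while e loop sᵗ) (⇓-agree d) (ext x))
    ⇓-agree (loop-ff {e} σ⊭e eq) rewrite eq = δ-⊭ e σ⊭e ret
    ⇓-agree (input eq h) rewrite eq = inp (λ v → skip-agree n (h v))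
    ⇓-agree (output eq h) rewrite eq = out (skip-agree n h)

  ⇒*-extends : ∀ n {t q q′} → ⟨ t , q ⟩⇒* q′ → Extends {Agrees n} t q q′
  ⇒*-extends zero    _ _ = tt
  ⇒*-extends (suc n) {t} (R , rules , x) a with rules x
  -- Members of `X` lie in `R`, hence are again extended evaluations, and the induction hypothesis
  -- at depth `n` covers them.
  ... | retᵣ eq X _ X⊆R d rewrite eq =
    bind-ret t a (⇓-agree n (λ y → ⇒*-extends n (R , rules , X⊆R y)) d)
  ... | inpᵣ eq eq′ h rewrite eq | eq′ =
    bind-inp t a (λ v → ⇒*-extends n (R , rules , h v))
  ... | outᵣ eq eq′ h rewrite eq | eq′ =
    bind-out t a (⇒*-extends n (R , rules , h))

  ⇒ᵣ-agrees : ∀ {s σ r} → ⟨ s , σ ⟩⇒ᵣ r → ∀ n → Agrees n r (s , σ)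
  ⇒ᵣ-agrees d zero    = tt
  ⇒ᵣ-agrees d (suc n) = ⇓-agree n (⇒*-extends n) d

  inp⁻¹ : ∀ {R f g} → Agree R (inpᵣ f) (inp g) → ∀ v → R (f v) (g v)
  inp⁻¹ (inp h) = h

  out⁻¹ : ∀ {R v r c} → Agree R (outᵣ v r) (out v c) → R r c
  out⁻¹ (out h) = h

  δ⁻¹ : ∀ {R w c} → Agree R w (δ c) → Agree R w (stepᶜ c)
  δ⁻¹ (δ a) = a

  -- Since `w` and `u` are fixed, all the agreements strip the same delays. The one over `S` carries
  -- the recursion and shows that it ends.
  Agree-⋂ : ∀ {S : Resᵣ → Config → Set} {R : ℕ → Resᵣ → Config → Set} {w u} →
            Agree S w u → (∀ n → Agree (R n) w u) →
            Agree (λ r c → ∀ n → R n r c) w u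
  Agree-⋂ ret     h = ret
  Agree-⋂ (inp _) h = inp (λ v n → inp⁻¹ (h n) v)
  Agree-⋂ (out _) h = out (λ n → out⁻¹ (h n))
  Agree-⋂ (δ a)   h = δ (Agree-⋂ a (λ n → δ⁻¹ (h n)))

  ≡-strong : ∀ {q q⋆} → q ≡ q⋆ → StrongRules _≡_ q q⋆
  ≡-strong {q} refl with observe q in eq
  ... | ret _   = ret eq eq
  ... | inp _   = inp eq eq (λ _ → refl)
  ... | out _ _ = out eq eq refl
  ... | δ _     = δ eq eq refl

  ≈-refl : ∀ {r} → r ≈ r
  ≈-refl = _≡_ , ≡-strong , refl

  -- A delay on the right alone is absorbed into convergence; the rule that matches delays on both
  -- sides cannot apply, as `q` has none.
  weak-δʳ : ∀ {R q q⋆ q⋆₁} → (∀ {q₁} → ¬ q ▹ δ q₁) → q⋆ ▹ δ q⋆₁ →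
            WeakRules R q q⋆₁ → WeakRules R q q⋆
  weak-δʳ _  eq (ret d d⋆)   = ret d (δ eq d⋆)
  weak-δʳ _  eq (inp d d⋆ h) = inp d (δ eq d⋆) h
  weak-δʳ _  eq (out d d⋆ h) = out d (δ eq d⋆) h
  weak-δʳ ¬δ _  (δ eq _ _)   = contradiction eq ¬δ

  data Weak : Res → Res → Set where
    agree : ∀ {r c} → (∀ n → Agrees n r c) → Weak (emb r) (eval c)

  emb-≢δ : ∀ {q q₁} w → q ▹ mapF emb (embF w) → ¬ q ▹ δ q₁
  emb-≢δ (retᵣ _)   eq eq′ with () ← trans (sym eq) eq′
  emb-≢δ (inpᵣ _)   eq eq′ with () ← trans (sym eq) eq′
  emb-≢δ (outᵣ _ _) eq eq′ with () ← trans (sym eq) eq′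

  -- Stated for `run u` rather than `eval c`, so that induction can remove delays from `u` while `q`
  -- stays fixed.
  agree-weak : ∀ {q w u} → q ▹ mapF emb (embF w) →
               Agree (λ r c → ∀ n → Agrees n r c) w u → WeakRules Weak q (run u)
  agree-weak eq ret = ret (ret eq refl) (ret refl refl)
  agree-weak eq (inp h) =
    inp (inp eq refl (λ _ → ≈-refl)) (inp refl refl (λ _ → ≈-refl)) (λ v → agree (h v))
  agree-weak eq (out h) = out (out eq refl ≈-refl) (out refl refl ≈-refl) (agree h)
  agree-weak {w = w} eq (δ a) = weak-δʳ (emb-≢δ w eq) refl (agree-weak eq a)

  weak-rules : ∀ {q q⋆} → Weak q q⋆ → WeakRules Weak q q⋆
  weak-rules (agree {r} h) =
    -- Depth 1 is the least depth that reveals a node, since depth 0 asserts nothing.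
    agree-weak (observe-emb r) (Agree-⋂ (h 1) (λ n → h (suc n)))
    where
    observe-emb : ∀ r → emb r ▹ mapF emb (embF (observeᵣ r))
    observe-emb = observe-corec (λ r → embF (observeᵣ r))

proposition6p1 : (L : Language) →
    let open Semantics L in
    ∀ (s : Stmt) (σ : State) (r : Resᵣ) →
    ⟨ s , σ ⟩⇒ᵣ r →
    ∃[ r′ ] ⟨ s , σ ⟩⇒ r′ × emb r ≅ r′
proposition6p1 L s σ r d =
  eval (s , σ) , ⇒-eval s σ , Weak , weak-rules , agree (⇒ᵣ-agrees d)
  where open Soundness L
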